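{- Let $\mathbf{P}=\{p_n(x)\}_{n\ge0}$ be a sequence of complex polynomials with $\deg p_n=n$, $p_0=1$, and let $\bar{\mathbf{P}}=\{\bar p_n(x)\}$ with $\bar p_0(x)=1$, $\bar p_n(x)=xp_{n-1}(x)$ for $n\ge1$. Then for all $n\ge0$, $$A_{n+1}(x;\bar{\mathbf{P}})=(1+nx)A_n(x;\mathbf{P})+x(1-x)A_n'(x;\mathbf{P}),$$ where $'$ denotes the derivative in $x$.
   Context: For any sequence $\mathbf{Q}=\{q_n\}$ with $\deg q_n=n$, $q_0=1$, the Eulerian numbers $A_{n,k}(\mathbf{Q})$ ($0\le k\le n$) are the unique coefficients with $q_n(x)=\sum_{k=0}^{n}A_{n,k}(\mathbf{Q})\binom{x+n-k-1}{n}$, where $\binom{y}{n}=y(y-1)\cdots(y-n+1)/n!$, and $A_n(x;\mathbf{Q})=\sum_{k=0}^n A_{n,k}(\mathbf{Q})x^k$. -}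

module Defs where

open import Algebra.Apartness.Bundles using (HeytingField; HeytingCommutativeRing)
open import Algebra.Bundles using (CommutativeRing)
open import Algebra.Bundles.Raw using (RawSemiring)
import Algebra.Apartness.Properties.HeytingCommutativeRing as HeytingProperties
import Algebra.Definitions.RawMonoid as RawMonoidDefinitions
import Algebra.Definitions.RawSemiring as RawSemiringDefinitions
open import Data.Fin.Base using (toℕ)
open import Data.List.Base using (List; []; _∷_; map)
open import Data.Nat.Base as ℕ using (ℕ; zero; suc; NonZero; _!)
open import Data.Nat.Properties using (_!≢0)
open import Data.Product.Base using (_×_; _,_; proj₁)
open import Data.Vec.Functional using (Vector)
open import Level using (_⊔_)

-- Fields are Heyting fields: every element apart from 0 has an inverse.  The
-- constructive complex numbers form such a field, as does, with  x # y  read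
-- as  ¬ (x ≈ y), every discrete field.

module _ {c ℓ₁ ℓ₂} (K : HeytingField c ℓ₁ ℓ₂) where
  open HeytingField K
  open CommutativeRing (HeytingCommutativeRing.commutativeRing heytingCommutativeRing)
    using (+-rawMonoid)
  open RawMonoidDefinitions +-rawMonoid using () renaming (_×_ to _·_)

  CharacteristicZero : Set ℓ₂
  CharacteristicZero = ∀ n → .{{_ : NonZero n}} → n · 1# # 0#

module Polynomials {c ℓ₁ ℓ₂} (K : HeytingField c ℓ₁ ℓ₂) where
  open HeytingField K
  open HeytingProperties heytingCommutativeRing using (1#0; #-congʳ)
  open CommutativeRing (HeytingCommutativeRing.commutativeRing heytingCommutativeRing)
    using (+-rawMonoid)
  open RawMonoidDefinitions +-rawMonoid using () renaming (_×_ to _·_)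

  -- a₀ ∷ a₁ ∷ … ∷ aₙ ∷ []  is  a₀ + a₁ x + … + aₙ xⁿ.  Trailing zeros are
  -- allowed, so the length says nothing about the degree, and equality of
  -- polynomials is _≈ₚ_.
  Polynomial : Set c
  Polynomial = List Carrier

  coefficient : Polynomial → ℕ → Carrier
  coefficient []      _       = 0#
  coefficient (a ∷ p) zero    = a
  coefficient (a ∷ p) (suc i) = coefficient p i

  infix 4 _≈ₚ_
  _≈ₚ_ : Polynomial → Polynomial → Set ℓ₁
  p ≈ₚ q = ∀ i → coefficient p i ≈ coefficient q i

  HasDegree : Polynomial → ℕ → Set (ℓ₁ ⊔ ℓ₂)
  HasDegree p n = coefficient p n # 0# × (∀ i → n ℕ.< i → coefficient p i ≈ 0#)

  infixl 6 _+ₚ_ _-ₚ_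
  infixl 7 _*ₚ_ _•_
  infix  8 -ₚ_

  constant : Carrier → Polynomial
  constant a = a ∷ []

  0ₚ 1ₚ X : Polynomial
  0ₚ = []
  1ₚ = constant 1#
  X  = 0# ∷ 1# ∷ []

  _+ₚ_ : Polynomial → Polynomial → Polynomial
  []      +ₚ q       = q
  (a ∷ p) +ₚ []      = a ∷ p
  (a ∷ p) +ₚ (b ∷ q) = a + b ∷ p +ₚ q

  -ₚ_ : Polynomial → Polynomial
  -ₚ_ = map (-_)

  _-ₚ_ : Polynomial → Polynomial → Polynomial
  p -ₚ q = p +ₚ (-ₚ q)

  _•_ : Carrier → Polynomial → Polynomial
  a • p = map (a *_) p

  _*ₚ_ : Polynomial → Polynomial → Polynomial
  []      *ₚ q = []
  (a ∷ p) *ₚ q = a • q +ₚ (0# ∷ p *ₚ q)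

  rawSemiringₚ : RawSemiring c ℓ₁
  rawSemiringₚ = record
    { _≈_ = _≈ₚ_ ; _+_ = _+ₚ_ ; _*_ = _*ₚ_ ; 0# = 0ₚ ; 1# = 1ₚ }

  open RawSemiringDefinitions rawSemiringₚ public
    using () renaming (sum to sumₚ; _^_ to _^ₚ_)

  weightFrom : ℕ → Polynomial → Polynomial
  weightFrom k []      = []
  weightFrom k (a ∷ p) = k · a ∷ weightFrom (suc k) p

  -- a₀ + a₁ x + a₂ x² + …  ↦  1 a₁ + 2 a₂ x + …
  derivative : Polynomial → Polynomial
  derivative []      = []
  derivative (a ∷ p) = weightFrom 1 p

  ι : ℕ → Carrier
  ι n = n · 1#

  coefficient-+ₚ : ∀ p q i →
                   coefficient (p +ₚ q) i ≈ coefficient p i + coefficient q i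
  coefficient-+ₚ []      q       i       = sym (+-identityˡ _)
  coefficient-+ₚ (a ∷ p) []      i       = sym (+-identityʳ _)
  coefficient-+ₚ (a ∷ p) (b ∷ q) zero    = refl
  coefficient-+ₚ (a ∷ p) (b ∷ q) (suc i) = coefficient-+ₚ p q i

  coefficient-• : ∀ a p i → coefficient (a • p) i ≈ a * coefficient p i
  coefficient-• a []      i       = sym (zeroʳ a)
  coefficient-• a (b ∷ p) zero    = refl
  coefficient-• a (b ∷ p) (suc i) = coefficient-• a p i

  coefficient-[0] : ∀ i → coefficient (0# ∷ []) i ≈ 0#
  coefficient-[0] zero    = refl
  coefficient-[0] (suc i) = refl

  coefficient-X*ₚ : ∀ p i → coefficient (X *ₚ p) (suc i) ≈ coefficient p i
  coefficient-X*ₚ p i =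
    trans (coefficient-+ₚ (0# • p) (0# ∷ (constant 1# *ₚ p)) (suc i))
    (trans (+-cong (trans (coefficient-• 0# p (suc i)) (zeroˡ _))
                   (trans (coefficient-+ₚ (1# • p) (0# ∷ []) i)
                          (+-cong (trans (coefficient-• 1# p i) (*-identityˡ _))
                                  (coefficient-[0] i))))
    (trans (+-identityˡ _) (+-identityʳ _)))

  record PolynomialSequence : Set (c ⊔ ℓ₁ ⊔ ℓ₂) where
    field
      poly      : ℕ → Polynomial
      hasDegree : ∀ n → HasDegree (poly n) n
      poly-0    : poly 0 ≈ₚ 1ₚ

  open PolynomialSequence public

  bar : PolynomialSequence → PolynomialSequence
  bar P = record { poly = p̄ ; hasDegree = deg ; poly-0 = λ _ → refl }
    where
    p̄ : ℕ → Polynomial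
    p̄ zero    = 1ₚ
    p̄ (suc n) = X *ₚ poly P n

    deg : ∀ n → HasDegree (p̄ n) n
    deg zero = 1#0 , λ { (suc i) _ → refl }
    deg (suc n) with hasDegree P n
    ... | lead , high =
      #-congʳ (sym (coefficient-X*ₚ (poly P n) n)) lead ,
      λ { (suc i) (ℕ.s≤s n<i) →
          trans (coefficient-X*ₚ (poly P n) i) (high i n<i) }

module Eulerian {c ℓ₁ ℓ₂} (K : HeytingField c ℓ₁ ℓ₂)
                (char0 : CharacteristicZero K) where
  open HeytingField K
  open Polynomials K

  -- #⇒invertible provides the inverse of  ι (n !) - 0#.
  1/_! : ℕ → Carrier
  1/ n ! = proj₁ (#⇒invertible (char0 (n !) {{n !≢0}}))

  -- y (y - 1) ⋯ (y - n + 1)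
  fallingFactorial : Polynomial → ℕ → Polynomial
  fallingFactorial y zero    = 1ₚ
  fallingFactorial y (suc n) = fallingFactorial y n *ₚ (y -ₚ constant (ι n))

  binomial : Polynomial → ℕ → Polynomial
  binomial y n = 1/ n ! • fallingFactorial y n

  -- The integer  n - k - 1  is computed in K, since it is -1 for k = n.
  eulerianBasis : ℕ → ℕ → Polynomial
  eulerianBasis n k = binomial (X +ₚ constant (ι n - ι k - 1#)) n

  -- A n k, for k : Fin (suc n), is the Eulerian number indexed by n and k ≤ n.
  -- Since the polynomials  eulerianBasis n k  (k ≤ n)  form a basis of the
  -- polynomials of degree at most n, exactly one A (up to _≈_) satisfies this.
  AreEulerianNumbers : PolynomialSequence → (∀ n → Vector Carrier (suc n)) → Set ℓ₁
  AreEulerianNumbers Q A =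
    ∀ n → poly Q n ≈ₚ sumₚ (λ k → A n k • eulerianBasis n (toℕ k))

  eulerianPolynomial : (∀ n → Vector Carrier (suc n)) → ℕ → Polynomial
  eulerianPolynomial A n = sumₚ (λ k → A n k • (X ^ₚ toℕ k))

{-# OPTIONS --safe #-}

-- Write B n k for eulerianBasis n k.  Since
--   x B n k = (1 + k) B (n + 1) k + (n - k) B (n + 1) (k + 1),
-- multiplying Σ aₖ B n k by x gives Σ bₖ B (n + 1) k with b₀ = a₀ and
-- bᵢ₊₁ = (2 + i) aᵢ₊₁ + (n - i) aᵢ, and these are exactly the coefficients of
-- (1 + n x) a + x (1 - x) a′.  The values of B n k at 1, …, n + 1 form a
-- unitriangular matrix, so the coefficients in this basis are unique.

module Submission where

open import Algebra.Apartness.Bundles using (HeytingField; HeytingCommutativeRing)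
open import Algebra.Bundles using (CommutativeRing)
import Algebra.Apartness.Properties.HeytingCommutativeRing as HeytingProperties
import Algebra.Properties.AbelianGroup as AbelianGroupProperties
import Algebra.Properties.Group as GroupProperties
import Algebra.Properties.Ring as RingProperties
import Algebra.Properties.Semiring.Mult as SemiringMult
import Algebra.Properties.Semiring.Sum as SemiringSum
import Algebra.Solver.Ring.NaturalCoefficients.Default as SemiringSolver
open import Data.Fin.Base as Fin using (Fin; zero; suc; toℕ; fromℕ; fromℕ<; inject₁; punchIn)
open import Data.Fin.Induction using (<-wellFounded)
open import Data.Fin.Properties
  using (<-cmp; punchInᵢ≢i; toℕ<n; toℕ≤pred[n]; toℕ-fromℕ; toℕ-fromℕ<; toℕ-injective; toℕ-inject₁)
open import Data.List.Base using ([]; _∷_)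
open import Data.Nat.Base as ℕ using (ℕ; zero; suc; _∸_; _!; s≤s; s≤s⁻¹)
open import Data.Nat.Properties as ℕ using (_!≢0)
open import Data.Product.Base using (proj₁; proj₂)
open import Data.Sum.Base using (inj₁; inj₂)
open import Data.Vec.Functional using (Vector; removeAt)
open import Defs
open import Function.Base using (_∘_)
open import Induction.WellFounded using (Acc; acc)
open import Relation.Binary.Definitions using (tri<; tri≈; tri>)
open import Relation.Binary.PropositionalEquality.Core as ≡ using (_≡_; _≢_)
import Relation.Binary.Reasoning.Setoid as SetoidReasoning
open import Relation.Nullary.Negation using (contradiction)

-- Finite sums and unitriangular systems over a commutative ring.

module FiniteSums {c ℓ} (R : CommutativeRing c ℓ) where
  open CommutativeRing R
  open SemiringSum semiring
  open GroupProperties +-group using () renaming (∙-cancelʳ to +-cancelʳ)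
  open SetoidReasoning setoid

  sum-zero : ∀ {n} (t : Vector Carrier n) → (∀ k → t k ≈ 0#) → sum t ≈ 0#
  sum-zero {n} t t≈0 = trans (sum-cong-≋ t≈0) (sum-replicate-zero n)

  sum-unique : ∀ {n} (t : Vector Carrier n) i → (∀ k → k ≢ i → t k ≈ 0#) → sum t ≈ t i
  sum-unique {suc n} t i t≈0 = begin
    sum t                     ≈⟨ sum-remove t ⟩
    t i + sum (removeAt t i)  ≈⟨ +-congˡ (sum-zero (removeAt t i) λ k → t≈0 _ (punchInᵢ≢i i k)) ⟩
    t i + 0#                  ≈⟨ +-identityʳ (t i) ⟩
    t i                       ∎

  -- Forward substitution, by well-founded induction on the row `j`. In row `j` the terms with `k`
  -- below `j` agree by induction and those above `j` are zero, so everything off the diagonal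
  -- cancels; the diagonal entry 1 then leaves `c j ≈ d j`.
  unitriangular-injective :
    ∀ {n} (M : Fin n → Fin n → Carrier) →
    (∀ j → M j j ≈ 1#) → (∀ {j k} → j Fin.< k → M j k ≈ 0#) →
    (c d : Vector Carrier n) →
    (∀ j → ∑[ k < n ] (c k * M j k) ≈ ∑[ k < n ] (d k * M j k)) →
    ∀ j → c j ≈ d j
  unitriangular-injective {suc n} M M≈1 M≈0 c d Mc≈Md j = go j (<-wellFounded j)
    where
    go : ∀ j → Acc Fin._<_ j → c j ≈ d j
    go j (acc rec) = begin
      c j           ≈⟨ *-identityʳ (c j) ⟨
      c j * 1#      ≈⟨ *-congˡ (M≈1 j) ⟨
      c j * M j j   ≈⟨ +-cancelʳ _ _ _ head≈ ⟩
      d j * M j j   ≈⟨ *-congˡ (M≈1 j) ⟩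
      d j * 1#      ≈⟨ *-identityʳ (d j) ⟩
      d j           ∎
      where
      s t : Vector Carrier (suc n)
      s k = c k * M j k
      t k = d k * M j k

      off-diagonal : ∀ k → k ≢ j → s k ≈ t k
      off-diagonal k k≢j with <-cmp k j
      ... | tri< k<j _ _ = *-congʳ (go k (rec k<j))
      ... | tri≈ _ k≡j _ = contradiction k≡j k≢j
      ... | tri> _ _ j<k = trans (trans (*-congˡ (M≈0 j<k)) (zeroʳ _))
                                 (sym (trans (*-congˡ (M≈0 j<k)) (zeroʳ _)))

      head≈ : s j + sum (removeAt t j) ≈ t j + sum (removeAt t j)
      head≈ = begin
        s j + sum (removeAt t j)  ≈⟨ +-congˡ (sum-cong-≋ λ k → off-diagonal _ (punchInᵢ≢i j k)) ⟨
        s j + sum (removeAt s j)  ≈⟨ sum-remove s ⟨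
        sum s                     ≈⟨ Mc≈Md j ⟩
        sum t                     ≈⟨ sum-remove t ⟩
        t j + sum (removeAt t j)  ∎

module PolynomialProperties {c ℓ₁ ℓ₂} (K : HeytingField c ℓ₁ ℓ₂) where
  open HeytingField K hiding (zero)
  open Polynomials K

  commutativeRing : CommutativeRing c ℓ₁
  commutativeRing = HeytingCommutativeRing.commutativeRing heytingCommutativeRing

  open CommutativeRing commutativeRing
    using (ring; semiring; commutativeSemiring; +-abelianGroup)
  open FiniteSums commutativeRing public
  open SemiringSum semiring public
  open SemiringMult semiring public using (_×_; ×-assoc-*; ×-congʳ; ×-homo-+; ×1-homo-*)
  open RingProperties ring public using (-0#≈0#; -‿distribˡ-*; -1*x≈-x)
  open AbelianGroupProperties +-abelianGroup public
    using () renaming (⁻¹-∙-comm to -‿+-comm)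
  open SemiringSolver commutativeSemiring public
    using (solve; _:=_; _:+_; _:*_; con)
  open SetoidReasoning setoid

  -- Evaluation of polynomials.

  eval : Polynomial → Carrier → Carrier
  eval []      x = 0#
  eval (a ∷ p) x = a + x * eval p x

  -- A list that represents zero need not be empty. This settles the cases of `eval-cong` in which
  -- one of two equal polynomials has surplus trailing zeros.
  eval-0 : ∀ p x → (∀ i → coefficient p i ≈ 0#) → eval p x ≈ 0#
  eval-0 []      x p≈0 = refl
  eval-0 (a ∷ p) x p≈0 = begin
    a + x * eval p x  ≈⟨ +-cong (p≈0 0) (*-congˡ (eval-0 p x (p≈0 ∘ suc))) ⟩
    0# + x * 0#       ≈⟨ trans (+-identityˡ _) (zeroʳ x) ⟩
    0#                ∎

  eval-cong : ∀ p q x → p ≈ₚ q → eval p x ≈ eval q x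
  eval-cong []      q       x p≈q = sym (eval-0 q x (sym ∘ p≈q))
  eval-cong (a ∷ p) []      x p≈q = eval-0 (a ∷ p) x p≈q
  eval-cong (a ∷ p) (b ∷ q) x p≈q = +-cong (p≈q 0) (*-congˡ (eval-cong p q x (p≈q ∘ suc)))

  eval-+ₚ : ∀ p q x → eval (p +ₚ q) x ≈ eval p x + eval q x
  eval-+ₚ []      q       x = sym (+-identityˡ _)
  eval-+ₚ (a ∷ p) []      x = sym (+-identityʳ _)
  eval-+ₚ (a ∷ p) (b ∷ q) x = begin
    (a + b) + x * eval (p +ₚ q) x          ≈⟨ +-congˡ (*-congˡ (eval-+ₚ p q x)) ⟩
    (a + b) + x * (eval p x + eval q x)    ≈⟨ solve 5 (λ a b x p q →
      (a :+ b) :+ x :* (p :+ q) := (a :+ x :* p) :+ (b :+ x :* q)) refl a b x _ _ ⟩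
    (a + x * eval p x) + (b + x * eval q x)  ∎

  eval-• : ∀ a p x → eval (a • p) x ≈ a * eval p x
  eval-• a []      x = sym (zeroʳ a)
  eval-• a (b ∷ p) x = begin
    a * b + x * eval (a • p) x    ≈⟨ +-congˡ (*-congˡ (eval-• a p x)) ⟩
    a * b + x * (a * eval p x)    ≈⟨ solve 4 (λ a b x p →
      a :* b :+ x :* (a :* p) := a :* (b :+ x :* p)) refl a b x _ ⟩
    a * (b + x * eval p x)        ∎

  eval-*ₚ : ∀ p q x → eval (p *ₚ q) x ≈ eval p x * eval q x
  eval-*ₚ []      q x = sym (zeroˡ _)
  eval-*ₚ (a ∷ p) q x = begin
    eval (a • q +ₚ (0# ∷ p *ₚ q)) x                    ≈⟨ eval-+ₚ (a • q) _ x ⟩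
    eval (a • q) x + (0# + x * eval (p *ₚ q) x)        ≈⟨ +-cong (eval-• a q x)
                                                           (+-congˡ (*-congˡ (eval-*ₚ p q x))) ⟩
    a * eval q x + (0# + x * (eval p x * eval q x))    ≈⟨ solve 4 (λ a x p q →
      a :* q :+ (con 0 :+ x :* (p :* q)) := (a :+ x :* p) :* q) refl a x _ _ ⟩
    (a + x * eval p x) * eval q x                      ∎

  eval-constant : ∀ a x → eval (constant a) x ≈ a
  eval-constant a x = trans (+-congˡ (zeroʳ x)) (+-identityʳ a)

  eval-X : ∀ x → eval X x ≈ x
  eval-X x = solve 1 (λ x → con 0 :+ x :* (con 1 :+ x :* con 0) := x) refl x

  eval-X+constant : ∀ a x → eval (X +ₚ constant a) x ≈ x + a
  eval-X+constant a x = trans (eval-+ₚ X (constant a) x) (+-cong (eval-X x) (eval-constant a x))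

  eval-sumₚ : ∀ {n} (f : Vector Polynomial n) x →
              eval (sumₚ f) x ≈ ∑[ k < n ] eval (f k) x
  eval-sumₚ {zero}  f x = refl
  eval-sumₚ {suc n} f x = trans (eval-+ₚ (f zero) _ x) (+-congˡ (eval-sumₚ (f ∘ suc) x))

  -- Coefficients of sums, products and powers of x.

  coefficient-sumₚ : ∀ {n} (f : Vector Polynomial n) i →
                     coefficient (sumₚ f) i ≈ ∑[ k < n ] coefficient (f k) i
  coefficient-sumₚ {zero}  f i = refl
  coefficient-sumₚ {suc n} f i =
    trans (coefficient-+ₚ (f zero) _ i) (+-congˡ (coefficient-sumₚ (f ∘ suc) i))

  coefficient-*ₚ-zero : ∀ a p q → coefficient ((a ∷ p) *ₚ q) 0 ≈ a * coefficient q 0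
  coefficient-*ₚ-zero a p q =
    trans (coefficient-+ₚ (a • q) _ 0) (trans (+-identityʳ _) (coefficient-• a q 0))

  coefficient-*ₚ-suc : ∀ a p q i → coefficient ((a ∷ p) *ₚ q) (suc i) ≈
                                   a * coefficient q (suc i) + coefficient (p *ₚ q) i
  coefficient-*ₚ-suc a p q i =
    trans (coefficient-+ₚ (a • q) _ (suc i)) (+-congʳ (coefficient-• a q (suc i)))

  coefficient-X*ₚ-zero : ∀ p → coefficient (X *ₚ p) 0 ≈ 0#
  coefficient-X*ₚ-zero p = trans (coefficient-*ₚ-zero 0# (1# ∷ []) p) (zeroˡ _)

  coefficient-X^-≡ : ∀ k → coefficient (X ^ₚ k) k ≈ 1#
  coefficient-X^-≡ zero    = refl
  coefficient-X^-≡ (suc k) = trans (coefficient-X*ₚ (X ^ₚ k) k) (coefficient-X^-≡ k)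

  coefficient-X^-≢ : ∀ k i → k ≢ i → coefficient (X ^ₚ k) i ≈ 0#
  coefficient-X^-≢ zero    zero    k≢i = contradiction ≡.refl k≢i
  coefficient-X^-≢ zero    (suc i) k≢i = refl
  coefficient-X^-≢ (suc k) zero    k≢i = coefficient-X*ₚ-zero (X ^ₚ k)
  coefficient-X^-≢ (suc k) (suc i) k≢i =
    trans (coefficient-X*ₚ (X ^ₚ k) i) (coefficient-X^-≢ k i (k≢i ∘ ≡.cong suc))

  module _ {n} (a : Vector Carrier n) where
    private
      terms : Vector Polynomial n
      terms k = a k • (X ^ₚ toℕ k)

      p : Polynomial
      p = sumₚ terms

      term-≢ : ∀ i k → toℕ k ≢ i → coefficient (a k • (X ^ₚ toℕ k)) i ≈ 0#
      term-≢ i k k≢i = trans (coefficient-• (a k) (X ^ₚ toℕ k) i)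
        (trans (*-congˡ (coefficient-X^-≢ (toℕ k) i k≢i)) (zeroʳ (a k)))

    -- Only the term with exponent `toℕ j` contributes, the exponents being distinct. Applied to
    -- `A n`, this reads the Eulerian numbers off the Eulerian polynomial.
    coefficient-∑X^ : ∀ j → coefficient p (toℕ j) ≈ a j
    coefficient-∑X^ j = begin
      coefficient p (toℕ j)                               ≈⟨ coefficient-sumₚ terms (toℕ j) ⟩
      ∑[ k < n ] coefficient (a k • (X ^ₚ toℕ k)) (toℕ j)  ≈⟨ sum-unique _ j (λ k k≢j →
                                                               term-≢ (toℕ j) k (k≢j ∘ toℕ-injective)) ⟩
      coefficient (a j • (X ^ₚ toℕ j)) (toℕ j)            ≈⟨ coefficient-• (a j) (X ^ₚ toℕ j) (toℕ j) ⟩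
      a j * coefficient (X ^ₚ toℕ j) (toℕ j)              ≈⟨ *-congˡ (coefficient-X^-≡ (toℕ j)) ⟩
      a j * 1#                                            ≈⟨ *-identityʳ (a j) ⟩
      a j                                                 ∎

    coefficient-∑X^-≥ : ∀ i → n ℕ.≤ i → coefficient p i ≈ 0#
    coefficient-∑X^-≥ i n≤i = trans (coefficient-sumₚ terms i) (sum-zero {n} _ λ k →
      term-≢ i k (ℕ.<⇒≢ (ℕ.<-≤-trans (toℕ<n k) n≤i)))

  -- Coefficients of the derivative and of the right-hand side of the recurrence.

  ×≈ι* : ∀ n x → n × x ≈ ι n * x
  ×≈ι* n x = sym (trans (×-assoc-* n 1# x) (×-congʳ n (*-identityˡ x)))

  coefficient-weightFrom : ∀ k p i →
    coefficient (weightFrom k p) i ≈ ι (k ℕ.+ i) * coefficient p i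
  coefficient-weightFrom k []      i       = sym (zeroʳ _)
  coefficient-weightFrom k (a ∷ p) zero    rewrite ℕ.+-identityʳ k = ×≈ι* k a
  coefficient-weightFrom k (a ∷ p) (suc i) rewrite ℕ.+-suc k i = coefficient-weightFrom (suc k) p i

  coefficient-derivative : ∀ p i →
    coefficient (derivative p) i ≈ ι (suc i) * coefficient p (suc i)
  coefficient-derivative []      i = sym (zeroʳ _)
  coefficient-derivative (a ∷ p) i = coefficient-weightFrom 1 p i

  coefficient-constant*ₚ : ∀ a q i → coefficient (constant a *ₚ q) i ≈ a * coefficient q i
  coefficient-constant*ₚ a q zero    = coefficient-*ₚ-zero a [] q
  coefficient-constant*ₚ a q (suc i) = trans (coefficient-*ₚ-suc a [] q i) (+-identityʳ _)

  coefficient-linear*ₚ : ∀ a b q i → coefficient ((a ∷ b ∷ []) *ₚ q) (suc i) ≈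
                                     a * coefficient q (suc i) + b * coefficient q i
  coefficient-linear*ₚ a b q i =
    trans (coefficient-*ₚ-suc a (constant b) q i) (+-congˡ (coefficient-constant*ₚ b q i))

  -- The first factor computes to a list with two unsimplified entries, `1# + (ν * 0# + 0#)` and
  -- `ν * 1#`, which are identified with 1 and ν.
  coefficient-[1+νX]*ₚ : ∀ ν q i → coefficient ((1ₚ +ₚ constant ν *ₚ X) *ₚ q) (suc i) ≈
                                   coefficient q (suc i) + ν * coefficient q i
  coefficient-[1+νX]*ₚ ν q i = trans (coefficient-linear*ₚ _ _ q i)
    (+-cong (trans (*-congʳ constant≈1) (*-identityˡ _)) (*-congʳ (*-identityʳ ν)))
    where
    constant≈1 : 1# + (ν * 0# + 0#) ≈ 1#
    constant≈1 = solve 1 (λ ν → con 1 :+ (ν :* con 0 :+ con 0) := con 1) refl ν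

  private
    -- `X *ₚ (1ₚ -ₚ X)` computes to a list of three unsimplified entries, which stand for 0, 1 and
    -- -1. The first two are simplified here by hand, because the semiring solver knows no negation.
    X[1-X]₀ : 0# * (1# + - 0#) + 0# ≈ 0#
    X[1-X]₀ = trans (+-identityʳ _) (zeroˡ _)

    X[1-X]₁ : 0# * - 1# + (1# * (1# + - 0#) + 0#) ≈ 1#
    X[1-X]₁ = begin
      0# * - 1# + (1# * (1# + - 0#) + 0#)  ≈⟨ +-cong (zeroˡ _) (+-identityʳ _) ⟩
      0# + 1# * (1# + - 0#)                ≈⟨ trans (+-identityˡ _) (*-identityˡ _) ⟩
      1# + - 0#                            ≈⟨ trans (+-congˡ -0#≈0#) (+-identityʳ 1#) ⟩
      1#                                   ∎

  coefficient-X[1-X]*ₚ-1 : ∀ q → coefficient (X *ₚ (1ₚ -ₚ X) *ₚ q) 1 ≈ coefficient q 0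
  coefficient-X[1-X]*ₚ-1 q = begin
    coefficient (X *ₚ (1ₚ -ₚ X) *ₚ q) 1
      ≈⟨ trans (coefficient-*ₚ-suc _ (_ ∷ _ ∷ []) q 0) (+-congˡ (coefficient-*ₚ-zero _ (_ ∷ []) q)) ⟩
    (0# * (1# + - 0#) + 0#) * coefficient q 1
      + (0# * - 1# + (1# * (1# + - 0#) + 0#)) * coefficient q 0
      ≈⟨ +-cong (trans (*-congʳ X[1-X]₀) (zeroˡ _)) (trans (*-congʳ X[1-X]₁) (*-identityˡ _)) ⟩
    0# + coefficient q 0  ≈⟨ +-identityˡ _ ⟩
    coefficient q 0       ∎

  -- The term -x² of x - x² first contributes at index 2, hence the separate treatment of index 1.
  coefficient-X[1-X]*ₚ-2+ : ∀ q i → coefficient (X *ₚ (1ₚ -ₚ X) *ₚ q) (suc (suc i)) ≈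
                                    coefficient q (suc i) - coefficient q i
  coefficient-X[1-X]*ₚ-2+ q i = begin
    coefficient (X *ₚ (1ₚ -ₚ X) *ₚ q) (suc (suc i))
      ≈⟨ trans (coefficient-*ₚ-suc _ (_ ∷ _ ∷ []) q (suc i)) (+-congˡ (coefficient-linear*ₚ _ _ q i)) ⟩
    (0# * (1# + - 0#) + 0#) * coefficient q (suc (suc i))
      + ((0# * - 1# + (1# * (1# + - 0#) + 0#)) * coefficient q (suc i)
         + 1# * - 1# * coefficient q i)
      ≈⟨ +-cong (trans (*-congʳ X[1-X]₀) (zeroˡ _))
           (+-cong (trans (*-congʳ X[1-X]₁) (*-identityˡ _)) (*-congʳ (*-identityˡ _))) ⟩
    0# + (coefficient q (suc i) + - 1# * coefficient q i)
      ≈⟨ trans (+-identityˡ _) (+-congˡ (-1*x≈-x _)) ⟩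
    coefficient q (suc i) - coefficient q i  ∎

  eulerianStep : ℕ → Polynomial → Polynomial
  eulerianStep n p = (1ₚ +ₚ constant (ι n) *ₚ X) *ₚ p +ₚ X *ₚ (1ₚ -ₚ X) *ₚ derivative p

  -- The argument `a` is indexed by all of ℕ, so that the entry at index `suc n` can mention
  -- `a (suc n)`, which is zero for a polynomial of degree at most n.
  eulerianStepCoefficient : ℕ → (ℕ → Carrier) → ℕ → Carrier
  eulerianStepCoefficient n a zero    = a 0
  eulerianStepCoefficient n a (suc i) = (1# + ι (suc i)) * a (suc i) + (ι n - ι i) * a i

  -- At index i + 1 the first product gives aᵢ₊₁ + n aᵢ and the second (i + 1) aᵢ₊₁ - i aᵢ;
  -- collecting the terms in aᵢ₊₁ and aᵢ gives the formula.
  coefficient-eulerianStep : ∀ n p i → coefficient (eulerianStep n p) i ≈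
                                       eulerianStepCoefficient n (coefficient p) i
  coefficient-eulerianStep n p i = trans (coefficient-+ₚ ((1ₚ +ₚ constant (ι n) *ₚ X) *ₚ p) _ i) (go i)
    where
    a : ℕ → Carrier
    a = coefficient p

    go : ∀ i → coefficient ((1ₚ +ₚ constant (ι n) *ₚ X) *ₚ p) i
                 + coefficient (X *ₚ (1ₚ -ₚ X) *ₚ derivative p) i
               ≈ eulerianStepCoefficient n a i
    go zero = begin
      _ ≈⟨ +-cong (coefficient-*ₚ-zero _ (_ ∷ []) p) (coefficient-*ₚ-zero _ (_ ∷ _ ∷ []) (derivative p)) ⟩
      (1# + (ι n * 0# + 0#)) * a 0 + (0# * (1# + - 0#) + 0#) * coefficient (derivative p) 0
        ≈⟨ solve 4 (λ ν a e d →
             (con 1 :+ (ν :* con 0 :+ con 0)) :* a :+ (con 0 :* e :+ con 0) :* d := a)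
             refl (ι n) (a 0) (1# + - 0#) _ ⟩
      a 0 ∎
    go (suc zero) = begin
      _ ≈⟨ +-cong (coefficient-[1+νX]*ₚ (ι n) p 0)
             (trans (coefficient-X[1-X]*ₚ-1 (derivative p)) (coefficient-derivative p 0)) ⟩
      (a 1 + ι n * a 0) + ι 1 * a 1
        ≈⟨ solve 4 (λ ν ι₁ a₁ a₀ →
             (a₁ :+ ν :* a₀) :+ ι₁ :* a₁ := (con 1 :+ ι₁) :* a₁ :+ (ν :+ con 0) :* a₀)
             refl (ι n) (ι 1) (a 1) (a 0) ⟩
      (1# + ι 1) * a 1 + (ι n + 0#) * a 0
        -- The zero supplied to the solver is rewritten as `- 0#`, and `0#` is what `ι 0` computes
        -- to.
        ≈⟨ +-congˡ (*-congʳ (+-congˡ -0#≈0#)) ⟨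
      (1# + ι 1) * a 1 + (ι n - 0#) * a 0  ∎
    go (suc (suc i)) = begin
      _ ≈⟨ +-cong (coefficient-[1+νX]*ₚ (ι n) p (suc i))
             (trans (coefficient-X[1-X]*ₚ-2+ (derivative p) i)
               (+-cong (coefficient-derivative p (suc i)) (-‿cong (coefficient-derivative p i)))) ⟩
      (a (2 ℕ.+ i) + ι n * a (1 ℕ.+ i)) + (ι (2 ℕ.+ i) * a (2 ℕ.+ i) - ι (1 ℕ.+ i) * a (1 ℕ.+ i))
        -- Moving the sign onto the factor makes `- ι (1 ℕ.+ i)` an atom, after which a semiring
        -- identity remains.
        ≈⟨ +-congˡ (+-congˡ (-‿distribˡ-* _ _)) ⟩
      (a (2 ℕ.+ i) + ι n * a (1 ℕ.+ i)) + (ι (2 ℕ.+ i) * a (2 ℕ.+ i) + - ι (1 ℕ.+ i) * a (1 ℕ.+ i))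
        ≈⟨ solve 5 (λ ν κ m a₂ a₁ →
             (a₂ :+ ν :* a₁) :+ (κ :* a₂ :+ m :* a₁) := (con 1 :+ κ) :* a₂ :+ (ν :+ m) :* a₁)
             refl (ι n) (ι (2 ℕ.+ i)) (- ι (1 ℕ.+ i)) _ _ ⟩
      (1# + ι (2 ℕ.+ i)) * a (2 ℕ.+ i) + (ι n - ι (1 ℕ.+ i)) * a (1 ℕ.+ i)  ∎

module EulerianProperties {c ℓ₁ ℓ₂} (K : HeytingField c ℓ₁ ℓ₂)
                          (char0 : CharacteristicZero K) where
  open HeytingField K hiding (zero)
  open Polynomials K
  open Eulerian K char0
  open PolynomialProperties K
  open HeytingProperties heytingCommutativeRing using (x-0≈x)
  open SetoidReasoning setoid

  -- Inverse factorials, and binomial coefficients of field elements.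

  1/n!*n!≈1 : ∀ n → 1/ n ! * ι (n !) ≈ 1#
  1/n!*n!≈1 n = trans (*-congˡ (sym (x-0≈x _)))
    (proj₁ (proj₂ (#⇒invertible (char0 (n !) {{n !≢0}}))))

  -- Both sides are inverse to n!: inserting 1 = v n! on the left and using (n + 1) n! = (n + 1)!
  -- makes `u` cancel and leaves `v`.
  1/[1+n]!*[1+n]≈1/n! : ∀ n → 1/ suc n ! * ι (suc n) ≈ 1/ n !
  1/[1+n]!*[1+n]≈1/n! n = begin
    u * ι (suc n)                        ≈⟨ *-identityʳ _ ⟨
    u * ι (suc n) * 1#                   ≈⟨ *-congˡ (1/n!*n!≈1 n) ⟨
    u * ι (suc n) * (v * ι (n !))        ≈⟨ solve 4 (λ u m v f →
      u :* m :* (v :* f) := u :* (m :* f) :* v) refl u (ι (suc n)) v (ι (n !)) ⟩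
    u * (ι (suc n) * ι (n !)) * v        ≈⟨ *-congʳ (*-congˡ (×1-homo-* (suc n) (n !))) ⟨
    u * ι (suc n !) * v                  ≈⟨ *-congʳ (1/n!*n!≈1 (suc n)) ⟩
    1# * v                               ≈⟨ *-identityˡ v ⟩
    v                                    ∎
    where
    u v : Carrier
    u = 1/ suc n !
    v = 1/ n !

  -- The counterpart of `fallingFactorial` on field elements, so that the identities below can be
  -- proved in the field after evaluation.
  falling : Carrier → ℕ → Carrier
  falling y zero    = 1#
  falling y (suc n) = falling y n * (y - ι n)

  choose : Carrier → ℕ → Carrier
  choose y n = 1/ n ! * falling y n

  falling-cong : ∀ {y z} n → y ≈ z → falling y n ≈ falling z n
  falling-cong zero    y≈z = refl
  falling-cong (suc n) y≈z = *-cong (falling-cong n y≈z) (+-congʳ y≈z)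

  choose-cong : ∀ {y z} n → y ≈ z → choose y n ≈ choose z n
  choose-cong n y≈z = *-congˡ (falling-cong n y≈z)

  eval-fallingFactorial : ∀ p n x → eval (fallingFactorial p n) x ≈ falling (eval p x) n
  eval-fallingFactorial p zero    x = eval-constant 1# x
  eval-fallingFactorial p (suc n) x = begin
    eval (fallingFactorial p n *ₚ (p -ₚ constant (ι n))) x
      ≈⟨ eval-*ₚ (fallingFactorial p n) _ x ⟩
    eval (fallingFactorial p n) x * eval (p -ₚ constant (ι n)) x
      ≈⟨ *-cong (eval-fallingFactorial p n x)
           (trans (eval-+ₚ p _ x) (+-congˡ (eval-constant (- ι n) x))) ⟩
    falling (eval p x) n * (eval p x - ι n)  ∎

  basisValue : ℕ → ℕ → Carrier → Carrier
  basisValue n k x = choose (x + (ι n - ι k - 1#)) n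

  eval-eulerianBasis : ∀ n k x → eval (eulerianBasis n k) x ≈ basisValue n k x
  eval-eulerianBasis n k x = begin
    eval (binomial y n) x               ≈⟨ eval-• (1/ n !) (fallingFactorial y n) x ⟩
    1/ n ! * eval (fallingFactorial y n) x  ≈⟨ *-congˡ (eval-fallingFactorial y n x) ⟩
    choose (eval y x) n                 ≈⟨ choose-cong n (eval-X+constant _ x) ⟩
    basisValue n k x                    ∎
    where
    y : Polynomial
    y = X +ₚ constant (ι n - ι k - 1#)

  -- Falling factorials at shifted and at natural arguments.

  -‿cancel-+ : ∀ x y → x + (y - x) ≈ y
  -‿cancel-+ x y = begin
    x + (y - x)    ≈⟨ solve 3 (λ x y m → x :+ (y :+ m) := y :+ (x :+ m)) refl x y (- x) ⟩
    y + (x - x)    ≈⟨ +-congˡ (-‿inverseʳ x) ⟩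
    y + 0#         ≈⟨ +-identityʳ y ⟩
    y              ∎

  [1+x]-[1+y]≈x-y : ∀ x y → (1# + x) - (1# + y) ≈ x - y
  [1+x]-[1+y]≈x-y x y = begin
    (1# + x) - (1# + y)      ≈⟨ +-congˡ (-‿+-comm 1# y) ⟨
    (1# + x) + (- 1# - y)    ≈⟨ solve 4 (λ o x m y →
      (o :+ x) :+ (m :+ y) := o :+ ((x :+ y) :+ m)) refl 1# x (- 1#) (- y) ⟩
    1# + ((x - y) - 1#)      ≈⟨ -‿cancel-+ 1# (x - y) ⟩
    x - y                    ∎

  -- The definition splits off the last factor; this splits off the first one. Shifting the argument
  -- and the index together leaves each remaining factor unchanged.
  falling-1+ : ∀ y n → falling (1# + y) (suc n) ≈ (1# + y) * falling y n
  falling-1+ y zero = begin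
    1# * ((1# + y) - 0#)   ≈⟨ trans (*-identityˡ _) (x-0≈x _) ⟩
    1# + y                 ≈⟨ *-identityʳ _ ⟨
    (1# + y) * 1#          ∎
  falling-1+ y (suc n) = begin
    falling (1# + y) (suc n) * ((1# + y) - (1# + ι n))
      ≈⟨ *-cong (falling-1+ y n) ([1+x]-[1+y]≈x-y y (ι n)) ⟩
    (1# + y) * falling y n * (y - ι n)
      ≈⟨ *-assoc _ _ _ ⟩
    (1# + y) * (falling y n * (y - ι n))  ∎

  falling-n-n : ∀ n → falling (ι n) n ≈ ι (n !)
  falling-n-n zero    = sym (+-identityʳ 1#)
  falling-n-n (suc n) = begin
    falling (1# + ι n) (suc n)     ≈⟨ falling-1+ (ι n) n ⟩
    ι (suc n) * falling (ι n) n    ≈⟨ *-congˡ (falling-n-n n) ⟩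
    ι (suc n) * ι (n !)            ≈⟨ ×1-homo-* (suc n) (n !) ⟨
    ι (suc n !)                    ∎

  -- One of the factors is `ι m - ι m`.
  falling-< : ∀ {m n} → m ℕ.< n → falling (ι m) n ≈ 0#
  falling-< {m} {suc n} m<1+n with ℕ.m≤n⇒m<n∨m≡n (s≤s⁻¹ m<1+n)
  ... | inj₁ m<n    = trans (*-congʳ (falling-< m<n)) (zeroˡ _)
  ... | inj₂ ≡.refl = trans (*-congˡ (-‿inverseʳ (ι n))) (zeroʳ _)

  choose-n-n : ∀ n → choose (ι n) n ≈ 1#
  choose-n-n n = trans (*-congˡ (falling-n-n n)) (1/n!*n!≈1 n)

  choose-< : ∀ {m n} → m ℕ.< n → choose (ι m) n ≈ 0#
  choose-< m<n = trans (*-congˡ (falling-< m<n)) (zeroʳ _)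

  -- Values of the basis at 1, ..., n + 1.

  -- At the point j + 1 the summand 1 cancels the -1 in the argument of the basis polynomial. What
  -- is left is a natural number, as `k ≤ n` makes the truncated difference `n ∸ k` exact.
  basisValue-ι : ∀ {n k} j → k ℕ.≤ n → basisValue n k (ι (suc j)) ≈ choose (ι (j ℕ.+ (n ∸ k))) n
  basisValue-ι {n} {k} j k≤n = choose-cong n (begin
    (1# + ι j) + ((ι n - ι k) - 1#)      ≈⟨ solve 4 (λ o i d m →
      (o :+ i) :+ (d :+ m) := i :+ (o :+ (d :+ m))) refl 1# (ι j) (ι n - ι k) (- 1#) ⟩
    ι j + (1# + ((ι n - ι k) - 1#))      ≈⟨ +-congˡ (-‿cancel-+ 1# _) ⟩
    ι j + (ι n - ι k)                    ≈⟨ +-congˡ (+-congʳ ιn≈) ⟩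
    ι j + ((ι k + ι (n ∸ k)) - ι k)      ≈⟨ +-congˡ (trans (+-assoc _ _ _) (-‿cancel-+ (ι k) _)) ⟩
    ι j + ι (n ∸ k)                      ≈⟨ ×-homo-+ 1# j (n ∸ k) ⟨
    ι (j ℕ.+ (n ∸ k))                    ∎)
    where
    ιn≈ : ι n ≈ ι k + ι (n ∸ k)
    ιn≈ = trans (reflexive (≡.cong ι (≡.sym (ℕ.m+[n∸m]≡n k≤n)))) (×-homo-+ 1# k (n ∸ k))

  -- The k-th basis polynomial takes at j + 1 the value of the binomial coefficient of j + n - k
  -- over n. It is 1 for j = k, and 0 for j < k since the upper number is then a natural number
  -- below n.
  basisValue-injective :
    ∀ n (c d : Vector Carrier (suc n)) →
    (∀ x → ∑[ k ≤ n ] (c k * basisValue n (toℕ k) x) ≈ ∑[ k ≤ n ] (d k * basisValue n (toℕ k) x)) →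
    ∀ j → c j ≈ d j
  basisValue-injective n c d c≈d =
    unitriangular-injective (λ j k → basisValue n (toℕ k) (ι (suc (toℕ j)))) diagonal upper c d
      (λ j → c≈d (ι (suc (toℕ j))))
    where
    diagonal : ∀ (j : Fin (suc n)) → basisValue n (toℕ j) (ι (suc (toℕ j))) ≈ 1#
    diagonal j = begin
      basisValue n (toℕ j) (ι (suc (toℕ j)))     ≈⟨ basisValue-ι (toℕ j) (toℕ≤pred[n] j) ⟩
      choose (ι (toℕ j ℕ.+ (n ∸ toℕ j))) n       ≡⟨ ≡.cong (λ m → choose (ι m) n)
                                                      (ℕ.m+[n∸m]≡n (toℕ≤pred[n] j)) ⟩
      choose (ι n) n                             ≈⟨ choose-n-n n ⟩
      1#                                         ∎

    upper : ∀ {j k : Fin (suc n)} → j Fin.< k → basisValue n (toℕ k) (ι (suc (toℕ j))) ≈ 0#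
    upper {j} {k} j<k = trans (basisValue-ι (toℕ j) (toℕ≤pred[n] k))
      (choose-< (ℕ.<-≤-trans (ℕ.+-monoˡ-< (n ∸ toℕ k) j<k)
                             (ℕ.≤-reflexive (ℕ.m+[n∸m]≡n (toℕ≤pred[n] k)))))

  -- Multiplication by x in the basis.

  -- Stated with z = y - n and d = n - κ, it is a semiring identity: x is 1 + κ + z.
  *-choose : ∀ n z d κ → ι n ≈ d + κ →
             (1# + κ + z) * choose (z + ι n) n ≈
             (1# + κ) * choose (1# + (z + ι n)) (suc n) + d * choose (z + ι n) (suc n)
  *-choose n z d κ ιn≈d+κ = begin
    (1# + κ + z) * (1/ n ! * F)
      ≈⟨ *-congˡ (*-congʳ (1/[1+n]!*[1+n]≈1/n! n)) ⟨
    (1# + κ + z) * (u * (1# + ι n) * F)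
      ≈⟨ *-congˡ (*-congʳ (*-congˡ (+-congˡ ιn≈d+κ))) ⟩
    (1# + κ + z) * (u * (1# + (d + κ)) * F)
      ≈⟨ solve 5 (λ κ z u d F →
           (con 1 :+ κ :+ z) :* (u :* (con 1 :+ (d :+ κ)) :* F) :=
           (con 1 :+ κ) :* (u :* ((con 1 :+ (z :+ (d :+ κ))) :* F)) :+ d :* (u :* (F :* z)))
           refl κ z u d F ⟩
    (1# + κ) * (u * ((1# + (z + (d + κ))) * F)) + d * (u * (F * z))
      ≈⟨ +-cong (*-congˡ (*-congˡ (*-congʳ (+-congˡ (+-congˡ ιn≈d+κ)))))
                (*-congˡ (*-congˡ (*-congˡ y-n≈z))) ⟨
    (1# + κ) * (u * ((1# + y) * F)) + d * (u * (F * (y - ι n)))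
      ≈⟨ +-congʳ (*-congˡ (*-congˡ (falling-1+ y n))) ⟨
    (1# + κ) * choose (1# + y) (suc n) + d * choose y (suc n)  ∎
    where
    y u F : Carrier
    y = z + ι n
    u = 1/ suc n !
    F = falling y n

    y-n≈z : y - ι n ≈ z
    y-n≈z = trans (+-assoc _ _ _) (trans (+-congˡ (-‿inverseʳ (ι n))) (+-identityʳ z))

  -- This is `*-choose` with κ = k, d = n - k and z = x - (1 + k). Then y = z + n is the argument of
  -- the basis polynomials of indices (n, k) and (n + 1, k + 1), and 1 + y is that of index (n + 1,
  -- k).
  *-basisValue : ∀ n k x → x * basisValue n k x ≈
    (1# + ι k) * basisValue (suc n) k x + (ι n - ι k) * basisValue (suc n) (suc k) x
  *-basisValue n k x = begin
    x * choose (x + (ι n - ι k - 1#)) n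
      ≈⟨ *-cong (sym x≈) (choose-cong n y≈) ⟩
    (1# + ι k + z) * choose (z + ι n) n
      ≈⟨ *-choose n z (ι n - ι k) (ι k) (sym (trans (+-comm _ _) (-‿cancel-+ (ι k) (ι n)))) ⟩
    (1# + ι k) * choose (1# + (z + ι n)) (suc n) + (ι n - ι k) * choose (z + ι n) (suc n)
      ≈⟨ +-cong (*-congˡ (choose-cong (suc n) 1+y≈)) (*-congˡ (choose-cong (suc n) y≈′)) ⟩
    (1# + ι k) * basisValue (suc n) k x + (ι n - ι k) * basisValue (suc n) (suc k) x  ∎
    where
    z : Carrier
    z = x - (1# + ι k)

    x≈ : 1# + ι k + z ≈ x
    x≈ = -‿cancel-+ (1# + ι k) x

    y≈ : x + (ι n - ι k - 1#) ≈ z + ι n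
    y≈ = begin
      x + (ι n - ι k - 1#)      ≈⟨ solve 4 (λ x ν κ m →
        x :+ ((ν :+ κ) :+ m) := (x :+ (m :+ κ)) :+ ν) refl x (ι n) (- ι k) (- 1#) ⟩
      (x + (- 1# - ι k)) + ι n  ≈⟨ +-congʳ (+-congˡ (-‿+-comm 1# (ι k))) ⟩
      z + ι n                   ∎

    1+y≈ : 1# + (z + ι n) ≈ x + ((1# + ι n) - ι k - 1#)
    1+y≈ = begin
      1# + (z + ι n)                  ≈⟨ +-congˡ y≈ ⟨
      1# + (x + (ι n - ι k - 1#))     ≈⟨ solve 5 (λ o x ν κ m →
        o :+ (x :+ ((ν :+ κ) :+ m)) := x :+ (((o :+ ν) :+ κ) :+ m)) refl 1# x (ι n) (- ι k) (- 1#) ⟩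
      x + ((1# + ι n) - ι k - 1#)     ∎

    y≈′ : z + ι n ≈ x + ((1# + ι n) - (1# + ι k) - 1#)
    y≈′ = trans (sym y≈) (+-congˡ (+-congʳ (sym ([1+x]-[1+y]≈x-y (ι n) (ι k)))))

  -- Read from the right: each coefficient with index k + 1 splits into `U (suc k)`, coming from
  -- aₖ₊₁, and `W k`, coming from aₖ. The last `U` is zero because `a (suc n)` is, so the two sums
  -- have the same range and their k-th terms combine by `*-basisValue`.
  *-∑-basisValue : ∀ n (a : ℕ → Carrier) → a (suc n) ≈ 0# → ∀ x →
    x * ∑[ k ≤ n ] (a (toℕ k) * basisValue n (toℕ k) x) ≈
    ∑[ k ≤ suc n ] (eulerianStepCoefficient n a (toℕ k) * basisValue (suc n) (toℕ k) x)
  *-∑-basisValue n a a≈0 x = sym (begin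
    a 0 * B′ 0 + ∑[ k ≤ n ] (eulerianStepCoefficient n a (suc (toℕ k)) * B′ (suc (toℕ k)))
      ≈⟨ +-cong first (sum-cong-≋ {suc n} λ k → split (toℕ k)) ⟩
    U 0 + ∑[ k ≤ n ] (U (suc (toℕ k)) + W (toℕ k))
      ≈⟨ +-congˡ (∑-distrib-+ {suc n} (U ∘ suc ∘ toℕ) (W ∘ toℕ)) ⟩
    U 0 + (∑[ k ≤ n ] U (suc (toℕ k)) + ∑[ k ≤ n ] W (toℕ k))
      -- The sum up to `suc n` unfolds to `U 0` plus the shifted sum, so reassociating is enough to
      -- absorb `U 0`.
      ≈⟨ +-assoc _ _ _ ⟨
    ∑[ k ≤ suc n ] U (toℕ k) + ∑[ k ≤ n ] W (toℕ k)
      ≈⟨ +-congʳ dropLast ⟩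
    ∑[ k ≤ n ] U (toℕ k) + ∑[ k ≤ n ] W (toℕ k)
      ≈⟨ ∑-distrib-+ {suc n} (U ∘ toℕ) (W ∘ toℕ) ⟨
    ∑[ k ≤ n ] (U (toℕ k) + W (toℕ k))
      ≈⟨ sum-cong-≋ {suc n} (λ k → sym (combine (toℕ k))) ⟩
    ∑[ k ≤ n ] (x * (a (toℕ k) * basisValue n (toℕ k) x))
      ≈⟨ *-distribˡ-sum {suc n} x (λ k → a (toℕ k) * basisValue n (toℕ k) x) ⟨
    x * ∑[ k ≤ n ] (a (toℕ k) * basisValue n (toℕ k) x)  ∎)
    where
    B′ U W : ℕ → Carrier
    B′ k = basisValue (suc n) k x
    U k = (1# + ι k) * a k * B′ k
    W k = (ι n - ι k) * a k * B′ (suc k)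

    first : a 0 * B′ 0 ≈ U 0
    -- `ι 0` computes to `0#`, so the factor in `U 0` is 1 + 0.
    first = solve 2 (λ a b → a :* b := (con 1 :+ con 0) :* a :* b) refl (a 0) (B′ 0)

    split : ∀ k → eulerianStepCoefficient n a (suc k) * B′ (suc k) ≈ U (suc k) + W k
    split k = distribʳ _ _ _

    combine : ∀ k → x * (a k * basisValue n k x) ≈ U k + W k
    combine k = begin
      x * (a k * basisValue n k x)     ≈⟨ solve 3 (λ x a b → x :* (a :* b) := a :* (x :* b))
                                            refl x (a k) _ ⟩
      a k * (x * basisValue n k x)     ≈⟨ *-congˡ (*-basisValue n k x) ⟩
      a k * ((1# + ι k) * B′ k + (ι n - ι k) * B′ (suc k))
        ≈⟨ solve 5 (λ a s b t b′ → a :* (s :* b :+ t :* b′) := s :* a :* b :+ t :* a :* b′)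
             refl (a k) (1# + ι k) (B′ k) (ι n - ι k) (B′ (suc k)) ⟩
      U k + W k                        ∎

    dropLast : ∑[ k ≤ suc n ] U (toℕ k) ≈ ∑[ k ≤ n ] U (toℕ k)
    dropLast = begin
      ∑[ k ≤ suc n ] U (toℕ k)
        ≈⟨ sum-init-last {suc n} (U ∘ toℕ) ⟩
      ∑[ k ≤ n ] U (toℕ (inject₁ k)) + U (toℕ (fromℕ (suc n)))
        ≈⟨ +-cong (sum-cong-≋ {suc n} λ k → reflexive (≡.cong U (toℕ-inject₁ k)))
                  (reflexive (≡.cong U (toℕ-fromℕ (suc n)))) ⟩
      ∑[ k ≤ n ] U (toℕ k) + U (suc n)
        ≈⟨ +-congˡ (trans (*-congʳ (trans (*-congˡ a≈0) (zeroʳ _))) (zeroˡ _)) ⟩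
      ∑[ k ≤ n ] U (toℕ k) + 0#
        ≈⟨ +-identityʳ _ ⟩
      ∑[ k ≤ n ] U (toℕ k)  ∎

  -- Comparison of the two expansions, and the recurrence.

  eval-eulerianNumbers : ∀ Q A → AreEulerianNumbers Q A → ∀ n x →
    eval (poly Q n) x ≈ ∑[ k ≤ n ] (A n k * basisValue n (toℕ k) x)
  eval-eulerianNumbers Q A isEulerian n x = begin
    eval (poly Q n) x                                        ≈⟨ eval-cong (poly Q n) (sumₚ terms) x (isEulerian n) ⟩
    eval (sumₚ (λ k → A n k • eulerianBasis n (toℕ k))) x    ≈⟨ eval-sumₚ terms x ⟩
    ∑[ k ≤ n ] eval (A n k • eulerianBasis n (toℕ k)) x      ≈⟨ sum-cong-≋ {suc n} (λ k →
      trans (eval-• (A n k) (eulerianBasis n (toℕ k)) x)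
            (*-congˡ (eval-eulerianBasis n (toℕ k) x))) ⟩
    ∑[ k ≤ n ] (A n k * basisValue n (toℕ k) x)              ∎
    where
    terms : Vector Polynomial (suc n)
    terms k = A n k • eulerianBasis n (toℕ k)

  -- An index `suc i` above n + 1 refers only to `a (suc i)` and `a i`, and both indices exceed n.
  eulerianStepCoefficient-> : ∀ n a → (∀ i → n ℕ.< i → a i ≈ 0#) →
                              ∀ i → suc n ℕ.< i → eulerianStepCoefficient n a i ≈ 0#
  eulerianStepCoefficient-> n a a≈0 (suc i) (s≤s n<i) = begin
    (1# + ι (suc i)) * a (suc i) + (ι n - ι i) * a i
      ≈⟨ +-cong (*-congˡ (a≈0 (suc i) (ℕ.m<n⇒m<1+n n<i))) (*-congˡ (a≈0 i n<i)) ⟩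
    (1# + ι (suc i)) * 0# + (ι n - ι i) * 0#
      ≈⟨ +-cong (zeroʳ _) (zeroʳ _) ⟩
    0# + 0#
      ≈⟨ +-identityˡ 0# ⟩
    0#  ∎

  eulerianPolynomial-bar : (P : PolynomialSequence) (A Ā : (n : ℕ) → Vector Carrier (suc n)) →
    AreEulerianNumbers P A → AreEulerianNumbers (bar P) Ā →
    ∀ n → eulerianPolynomial Ā (suc n) ≈ₚ eulerianStep n (eulerianPolynomial A n)
  eulerianPolynomial-bar P A Ā isA isĀ n i =
    trans (coefficient-Ā i) (sym (coefficient-eulerianStep n (eulerianPolynomial A n) i))
    where
    a : ℕ → Carrier
    a = coefficient (eulerianPolynomial A n)

    a-> : ∀ i → n ℕ.< i → a i ≈ 0#
    a-> = coefficient-∑X^-≥ (A n)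

    Ā≈ : ∀ j → Ā (suc n) j ≈ eulerianStepCoefficient n a (toℕ j)
    -- The values of x pₙ(x) are expanded twice in the basis of degree n + 1: by the defining
    -- property of `Ā`, and by multiplying the expansion of pₙ by x.
    Ā≈ = basisValue-injective (suc n) _ _ λ x → begin
      ∑[ k ≤ suc n ] (Ā (suc n) k * basisValue (suc n) (toℕ k) x)
        ≈⟨ eval-eulerianNumbers (bar P) Ā isĀ (suc n) x ⟨
      eval (X *ₚ poly P n) x
        ≈⟨ eval-*ₚ X (poly P n) x ⟩
      eval X x * eval (poly P n) x
        ≈⟨ *-cong (eval-X x) (eval-eulerianNumbers P A isA n x) ⟩
      x * ∑[ k ≤ n ] (A n k * basisValue n (toℕ k) x)
        -- The finite vector `A n` is replaced by the coefficient sequence `a`, its extension by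
        -- zero, for which `a (suc n)` makes sense and vanishes.
        ≈⟨ *-congˡ (sum-cong-≋ {suc n} λ k → *-congʳ {basisValue n (toℕ k) x} (coefficient-∑X^ (A n) k)) ⟨
      x * ∑[ k ≤ n ] (a (toℕ k) * basisValue n (toℕ k) x)
        ≈⟨ *-∑-basisValue n a (a-> (suc n) ℕ.≤-refl) x ⟩
      ∑[ k ≤ suc n ] (eulerianStepCoefficient n a (toℕ k) * basisValue (suc n) (toℕ k) x)  ∎

    coefficient-Ā : ∀ i → coefficient (eulerianPolynomial Ā (suc n)) i ≈ eulerianStepCoefficient n a i
    -- Equality of polynomials concerns every index. Those up to n + 1 come from `Fin (2 ℕ.+ n)`,
    -- where `Ā≈` applies; beyond that both sides are zero.
    coefficient-Ā i with ℕ.<-≤-connex i (2 ℕ.+ n)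
    ... | inj₁ i<2+n = ≡.subst
      (λ i → coefficient (eulerianPolynomial Ā (suc n)) i ≈ eulerianStepCoefficient n a i)
      (toℕ-fromℕ< i<2+n)
      (trans (coefficient-∑X^ (Ā (suc n)) (fromℕ< i<2+n)) (Ā≈ (fromℕ< i<2+n)))
    ... | inj₂ 2+n≤i = trans (coefficient-∑X^-≥ (Ā (suc n)) i 2+n≤i)
      (sym (eulerianStepCoefficient-> n a a-> i 2+n≤i))

theorem3p3 : ∀ {c ℓ₁ ℓ₂} (K : HeytingField c ℓ₁ ℓ₂) (char0 : CharacteristicZero K) →
    let open HeytingField K using (Carrier)
        open Polynomials K
        open Eulerian K char0
    in (P : PolynomialSequence) (A Ā : (n : ℕ) → Vector Carrier (suc n)) →
       AreEulerianNumbers P A → AreEulerianNumbers (bar P) Ā →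
       (n : ℕ) →
       eulerianPolynomial Ā (suc n) ≈ₚ
         (1ₚ +ₚ constant (ι n) *ₚ X) *ₚ eulerianPolynomial A n
           +ₚ X *ₚ (1ₚ -ₚ X) *ₚ derivative (eulerianPolynomial A n)
theorem3p3 K char0 = EulerianProperties.eulerianPolynomial-bar K char0
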